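{- For all integers $n\ge 0$, $\mathrm{cp}_{0,1,1}(n)$ is the total number of parts (counted with multiplicity) among all partitions of $n$. Equivalently, $\mathrm{cp}_{0,1,1}(n)$ is the sum, over all partitions $\lambda$ of $n$, of the largest part of $\lambda$.
   Context: A partition of a non-negative integer $n$ is a finite multiset of positive integers (its parts) with sum $n$; the empty multiset is the unique partition of $0$ (it has no parts, and its largest part is taken to be $0$). A $(0,1,1)$-copartition is a triple $(\gamma,\rho,\sigma)$ where $\gamma$ is a finite (possibly empty) multiset of non-negative integers (so parts equal to $0$ are allowed in $\gamma$, with multiplicity, and count as parts), $\sigma$ is a nonempty finite multiset of positive integers, and $\rho$ is the multiset having the same number of parts as $\sigma$, each of which has size equal to the number of parts of $\gamma$ (zero parts of $\gamma$ included in the count; if $\gamma$ is empty, $\rho$ is regarded as empty). Its size is $|\gamma|+|\rho|+|\sigma|$, where $|\cdot|$ denotes the sum of parts. $\mathrm{cp}_{0,1,1}(n)$ is the number of $(0,1,1)$-copartitions of size $n$. -}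

module Defs where

open import Data.Empty using (⊥)
open import Data.List.Base
  using (List; []; _∷_; length; foldr; map; replicate; filter; upTo;
         cartesianProduct; cartesianProductWith)
open import Data.List.Membership.Propositional using (_∈_)
open import Data.List.Membership.Propositional.Properties
  using (∈-filter⁺; ∈-filter⁻; ∈-upTo⁺; ∈-cartesianProduct⁺; ∈-cartesianProductWith⁺;
         ∈-cartesianProductWith⁻)
open import Data.List.Properties
  using (≡-dec; length-replicate; ∷-injective)
open import Data.List.Relation.Unary.All as All using (All; []; _∷_)
open import Data.List.Relation.Unary.AllPairs using ([]; _∷_)
open import Data.List.Relation.Unary.Any using (here; there)
open import Data.List.Relation.Unary.Linked using (Linked; linked?)
open import Data.List.Relation.Unary.Unique.Propositional using (Unique)
open import Data.List.Relation.Unary.Unique.Propositional.Properties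
  using (filter⁺; upTo⁺; cartesianProduct⁺; cartesianProductWith⁺)
open import Data.Nat.Base
  using (ℕ; zero; suc; _+_; _⊔_; _≤_; _<_; _≥_; z≤n; s≤s)
open import Data.Nat.ListAction using (sum)
open import Data.Nat.Properties
  using (_≟_; _<?_; _≥?_; ≤-trans; ≤-reflexive; m≤m+n; m≤n+m; +-mono-≤)
open import Data.Product.Base using (_×_; _,_; proj₁; proj₂)
open import Relation.Binary.PropositionalEquality
  using (_≡_; _≢_; refl; sym; subst)
open import Relation.Nullary using (Dec; ¬?; contradiction)
open import Relation.Nullary.Decidable using (map′; _×-dec_)
open import Relation.Unary using (Decidable)

-- A finite multiset of natural numbers is represented by the unique weakly
-- decreasing list of its elements.
IsMultiset : List ℕ → Set
IsMultiset = Linked _≥_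

isMultiset? : Decidable IsMultiset
isMultiset? = linked? _≥?_

record IsPartition (n : ℕ) (parts : List ℕ) : Set where
  field
    multiset : IsMultiset parts
    positive : All (0 <_) parts
    size     : sum parts ≡ n

largestPart : List ℕ → ℕ
largestPart = foldr _⊔_ 0

-- ℓ parts, each of size k, where parts of size 0 are dropped: when γ is empty,
-- ρ is empty as well, rather than a collection of zero parts.
rectangle : (ℓ k : ℕ) → List ℕ
rectangle ℓ zero    = []
rectangle ℓ (suc k) = replicate ℓ (suc k)

-- (0,1,1)-copartitions: γ may have zero parts, the parts of σ are positive.
record IsCopartition₀₁₁ (γ ρ σ : List ℕ) : Set where
  field
    γ-multiset : IsMultiset γ
    σ-multiset : IsMultiset σ
    σ-positive : All (0 <_) σ
    σ-nonempty : σ ≢ []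
    ρ-parts    : ρ ≡ rectangle (length σ) (length γ)

Triple : Set
Triple = List ℕ × List ℕ × List ℕ

record IsCopartition₀₁₁Of (n : ℕ) (t : Triple) : Set where
  γ = proj₁ t
  ρ = proj₁ (proj₂ t)
  σ = proj₂ (proj₂ t)
  field
    copartition : IsCopartition₀₁₁ γ ρ σ
    size        : sum γ + sum ρ + sum σ ≡ n

record Enumeration {A : Set} (P : A → Set) : Set where
  field
    list     : List A
    unique   : Unique list
    sound    : ∀ {x} → x ∈ list → P x
    complete : ∀ {x} → P x → x ∈ list

open Enumeration using (list)

private
  enumerateWithin : {A : Set} {P : A → Set} → Decidable P →
                    (xs : List A) → Unique xs → (∀ {x} → P x → x ∈ xs) → Enumeration P
  enumerateWithin P? xs xs! P⊆xs = record
    { list     = filter P? xs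
    ; unique   = filter⁺ P? xs!
    ; sound    = λ x∈ → proj₂ (∈-filter⁻ P? {xs = xs} x∈)
    ; complete = λ px → ∈-filter⁺ P? (P⊆xs px) px
    }

  -- The lists of length at most ℓ with entries at most m.
  box : (m ℓ : ℕ) → List (List ℕ)
  box m zero    = [] ∷ []
  box m (suc ℓ) = [] ∷ cartesianProductWith _∷_ (upTo (suc m)) (box m ℓ)

  box-unique : ∀ m ℓ → Unique (box m ℓ)
  box-unique m zero    = [] ∷ []
  box-unique m (suc ℓ) =
    All.tabulate (λ xs∈ []≡xs → []∉ (subst (_∈ _) (sym []≡xs) xs∈))
    ∷ cartesianProductWith⁺ _∷_ ∷-injective (upTo⁺ (suc m)) (box-unique m ℓ)
    where
    []∉ : [] ∈ cartesianProductWith _∷_ (upTo (suc m)) (box m ℓ) → ⊥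
    []∉ []∈ with ∈-cartesianProductWith⁻ _∷_ (upTo (suc m)) (box m ℓ) []∈
    ... | _ , _ , _ , _ , ()

  box-complete : ∀ {m ℓ xs} → length xs ≤ ℓ → All (_≤ m) xs → xs ∈ box m ℓ
  box-complete {ℓ = zero}  {[]}     _         _            = here refl
  box-complete {ℓ = suc _} {[]}     _         _            = here refl
  box-complete {ℓ = suc _} {_ ∷ _}  (s≤s len) (x≤m ∷ xs≤m) =
    there (∈-cartesianProductWith⁺ _∷_ (∈-upTo⁺ (s≤s x≤m)) (box-complete len xs≤m))

  parts≤sum : ∀ xs → All (_≤ sum xs) xs
  parts≤sum []       = []
  parts≤sum (x ∷ xs) =
    m≤m+n x (sum xs) ∷ All.map (λ p → ≤-trans p (m≤n+m (sum xs) x)) (parts≤sum xs)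

  length≤sum : ∀ {xs} → All (0 <_) xs → length xs ≤ sum xs
  length≤sum []       = z≤n
  length≤sum (p ∷ ps) = +-mono-≤ p (length≤sum ps)

  ∈-box : ∀ {n xs} → length xs ≤ n → sum xs ≤ n → xs ∈ box n n
  ∈-box {xs = xs} len≤n sum≤n =
    box-complete len≤n (All.map (λ p → ≤-trans p sum≤n) (parts≤sum xs))

  isPartition? : ∀ n → Decidable (IsPartition n)
  isPartition? n xs = map′
    (λ (m , p , s) → record { multiset = m ; positive = p ; size = s })
    (λ p → let open IsPartition p in multiset , positive , size)
    (isMultiset? xs ×-dec All.all? (0 <?_) xs ×-dec (sum xs ≟ n))

  isCopartition? : ∀ γ ρ σ → Dec (IsCopartition₀₁₁ γ ρ σ)
  isCopartition? γ ρ σ = map′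
    (λ (a , b , c , d , e) → record
      { γ-multiset = a ; σ-multiset = b ; σ-positive = c ; σ-nonempty = d ; ρ-parts = e })
    (λ c → let open IsCopartition₀₁₁ c in
      γ-multiset , σ-multiset , σ-positive , σ-nonempty , ρ-parts)
    (isMultiset? γ ×-dec isMultiset? σ ×-dec All.all? (0 <?_) σ
      ×-dec ¬? (≡-dec _≟_ σ []) ×-dec ≡-dec _≟_ ρ (rectangle (length σ) (length γ)))

  isCopartitionOf? : ∀ n → Decidable (IsCopartition₀₁₁Of n)
  isCopartitionOf? n (γ , ρ , σ) = map′
    (λ (c , s) → record { copartition = c ; size = s })
    (λ c → let open IsCopartition₀₁₁Of c using (copartition; size) in copartition , size)
    (isCopartition? γ ρ σ ×-dec (sum γ + sum ρ + sum σ ≟ n))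

  length-rectangle : ∀ ℓ k → length (rectangle ℓ k) ≤ ℓ
  length-rectangle ℓ zero    = z≤n
  length-rectangle ℓ (suc k) = ≤-reflexive (length-replicate ℓ)

  k≤sum-rectangle : ∀ ℓ k → k ≤ sum (rectangle (suc ℓ) k)
  k≤sum-rectangle ℓ zero    = z≤n
  k≤sum-rectangle ℓ (suc k) = m≤m+n (suc k) _

  copartition∈box : ∀ {n t} → IsCopartition₀₁₁Of n t →
                    t ∈ cartesianProduct (box n n) (cartesianProduct (box n n) (box n n))
  copartition∈box {n} {γ , ρ , σ} c =
    ∈-cartesianProduct⁺ (∈-box (≤-trans γ-len ρ≤n) γ≤n)
      (∈-cartesianProduct⁺ (∈-box (≤-trans ρ-len σ-len) ρ≤n) (∈-box σ-len σ≤n))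
    where
    open IsCopartition₀₁₁Of c using (copartition; size)
    open IsCopartition₀₁₁ copartition
    γρ≤n : sum γ + sum ρ ≤ n
    γρ≤n = ≤-trans (m≤m+n _ (sum σ)) (≤-reflexive size)
    γ≤n : sum γ ≤ n
    γ≤n = ≤-trans (m≤m+n _ _) γρ≤n
    ρ≤n : sum ρ ≤ n
    ρ≤n = ≤-trans (m≤n+m _ (sum γ)) γρ≤n
    σ≤n : sum σ ≤ n
    σ≤n = ≤-trans (m≤n+m _ (sum γ + sum ρ)) (≤-reflexive size)
    σ-len : length σ ≤ n
    σ-len = ≤-trans (length≤sum σ-positive) σ≤n
    ρ-len : length ρ ≤ length σ
    ρ-len = subst (λ r → length r ≤ length σ) (sym ρ-parts)
              (length-rectangle (length σ) (length γ))
    nonempty-case : ∀ σ′ → σ′ ≢ [] → length γ ≤ sum (rectangle (length σ′) (length γ))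
    nonempty-case []       σ≢[] = contradiction refl σ≢[]
    nonempty-case (_ ∷ σ″) _    = k≤sum-rectangle (length σ″) (length γ)
    γ-len : length γ ≤ sum ρ
    γ-len = subst (λ r → length γ ≤ sum r) (sym ρ-parts) (nonempty-case σ σ-nonempty)

partitionsOf : ∀ n → Enumeration (IsPartition n)
partitionsOf n = enumerateWithin (isPartition? n) (box n n) (box-unique n n)
  (λ p → let open IsPartition p in
    ∈-box (≤-trans (length≤sum positive) (≤-reflexive size)) (≤-reflexive size))

copartitions₀₁₁Of : ∀ n → Enumeration (IsCopartition₀₁₁Of n)
copartitions₀₁₁Of n = enumerateWithin (isCopartitionOf? n) _
  (cartesianProduct⁺ (box-unique n n) (cartesianProduct⁺ (box-unique n n) (box-unique n n)))
  copartition∈box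

cp₀₁₁ : ℕ → ℕ
cp₀₁₁ n = length (list (copartitions₀₁₁Of n))

sumOverPartitionsOf : (n : ℕ) → (List ℕ → ℕ) → ℕ
sumOverPartitionsOf n f = sum (map f (list (partitionsOf n)))

{-# OPTIONS --safe #-}
module Submission where

-- Cut a partition λ of n in two at one of its parts: λ = α ++ β with β
-- nonempty, the marked part being the first entry of β.  There are as many such
-- cuts of λ as λ has parts, so the total number of parts of the partitions of n
-- is the number of marked partitions (α , β) of size n.
--
-- Marked partitions correspond to copartitions (`toCopartition`,
-- `fromCopartition`).  Let σ be the conjugate of β and let ℓ be its number of
-- parts, that is, the largest part of β.  The entries of α are all at least ℓ,
-- and subtracting ℓ from each leaves a multiset γ of non-negative integers; the
-- removed rectangle, of area ℓ · length α, is exactly ρ.  Conversely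
-- (γ , ρ , σ) comes from α = γ with ℓ added to each entry and β = σ conjugated:
-- every entry of α is at least ℓ, the largest part of β, so α ++ β is weakly
-- decreasing.
--
-- The largest part version follows because conjugation permutes the partitions
-- of n and exchanges the number of parts with the largest part.  That
-- conjugation is an involution is `conjugate-involutive`, which rests on
-- `conjugate-addRow`: a list obtained by adding a row of length x to the columns
-- of a diagram has as its conjugate the list of rows with x put in front.

open import Defs
open import Data.Nat.Base
  using (ℕ; zero; suc; _+_; _*_; _∸_; _⊔_; _≤_; _<_; _≥_; z≤n; s≤s; z<s)
open import Data.Nat.ListAction using (sum)
open import Data.Nat.ListAction.Properties using (sum-++; sum-↭)
open import Data.Nat.Properties
  using (≤-refl; ≤-trans; ≤-reflexive; +-monoʳ-≤; ∸-monoˡ-≤; +-comm; *-comm; +-identityʳ;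
         m+[n∸m]≡n; m+n∸m≡n; m≤m+n; m⊔n≤o⇒m≤o; m⊔n≤o⇒n≤o; ⊔-lub)
open import Data.Nat.Solver using (module +-*-Solver)
open import Data.List.Base
  using (List; []; _∷_; _++_; length; foldr; map; replicate; concatMap)
open import Data.List.Properties
  using (length-map; length-++; length-replicate; map-∘; map-cong; map-id; map-id-local;
         ∷-injectiveʳ; foldr-forcesᵇ; foldr-preservesᵇ)
open import Data.List.Membership.Propositional using (_∈_; find; lose)
open import Data.List.Membership.Propositional.Properties
  using (∈-map⁺; ∈-map⁻; ∈-concatMap⁺; ∈-concatMap⁻)
open import Data.List.Membership.Propositional.Properties.WithK using (unique∧set⇒bag)
open import Data.List.Relation.Binary.BagAndSetEquality using (∼bag⇒↭)
open import Data.List.Relation.Binary.Disjoint.Propositional using (Disjoint)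
open import Data.List.Relation.Binary.Permutation.Propositional using (_↭_)
open import Data.List.Relation.Binary.Permutation.Propositional.Properties
  using (↭-length) renaming (map⁺ to ↭-map⁺)
open import Data.List.Relation.Unary.All as All using (All; []; _∷_)
import Data.List.Relation.Unary.All.Properties as All
open import Data.List.Relation.Unary.AllPairs as AllPairs using (AllPairs; []; _∷_)
import Data.List.Relation.Unary.AllPairs.Properties as AllPairs
open import Data.List.Relation.Unary.Any using (here; there)
open import Data.List.Relation.Unary.Linked.Properties
  using (Linked⇒AllPairs; AllPairs⇒Linked)
open import Data.List.Relation.Unary.Unique.Propositional using (Unique)
import Data.List.Relation.Unary.Unique.Propositional.Properties as Unique
open import Data.Product.Base using (_×_; _,_; proj₁; proj₂; map₁)
open import Function.Base using (_∘_)
open import Function.Bundles using (mk⇔)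
open import Relation.Binary.PropositionalEquality
  using (_≡_; _≢_; refl; sym; trans; cong; cong₂; subst; module ≡-Reasoning)
open import Relation.Nullary using (contradiction)

open Enumeration using (list; unique; sound; complete)

-- Enumerations of predicates in bijection

-- A bijection between two predicates carries an enumeration of one to a
-- rearrangement of any enumeration of the other.
map-enumeration-↭ :
  {A B : Set} {P : A → Set} {Q : B → Set} (E : Enumeration P) (F : Enumeration Q)
  (f : A → B) (g : B → A) →
  (∀ {x} → P x → Q (f x)) → (∀ {y} → Q y → P (g y)) →
  (∀ {x} → P x → g (f x) ≡ x) → (∀ {y} → Q y → f (g y) ≡ y) →
  map f (list E) ↭ list F
map-enumeration-↭ E F f g P⇒Q Q⇒P gf fg =
  ∼bag⇒↭ (unique∧set⇒bag fE-unique (unique F) (mk⇔ to from))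
  where
  gfE≡E : map g (map f (list E)) ≡ list E
  gfE≡E = trans (sym (map-∘ (list E))) (map-id-local (All.tabulate (gf ∘ sound E)))

  -- f need only be injective on the enumerated elements, so uniqueness is
  -- pulled back along its left inverse g.
  fE-unique : Unique (map f (list E))
  fE-unique = Unique.map⁻ (subst Unique (sym gfE≡E) (unique E))

  to : ∀ {y} → y ∈ map f (list E) → y ∈ list F
  to y∈ with ∈-map⁻ f y∈
  ... | x , x∈ , refl = complete F (P⇒Q (sound E x∈))

  from : ∀ {y} → y ∈ list F → y ∈ map f (list E)
  from y∈ = subst (_∈ map f (list E)) (fg (sound F y∈))
              (∈-map⁺ f (complete E (Q⇒P (sound F y∈))))

-- Weakly decreasing lists

sorted : ∀ {xs} → IsMultiset xs → AllPairs _≥_ xs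
sorted = Linked⇒AllPairs (λ i≥j j≥k → ≤-trans j≥k i≥j)

++-sorted⁻ : ∀ xs {ys} → AllPairs _≥_ (xs ++ ys) →
             AllPairs _≥_ xs × AllPairs _≥_ ys × All (λ x → All (_≤ x) ys) xs
++-sorted⁻ []       s       = [] , s , []
++-sorted⁻ (x ∷ xs) (p ∷ s) =
  let sx , sy , c = ++-sorted⁻ xs s
  in All.++⁻ˡ xs p ∷ sx , sy , All.++⁻ʳ xs p ∷ c

map-sorted⁺ : ∀ {f : ℕ → ℕ} → (∀ {x y} → x ≤ y → f x ≤ f y) →
              ∀ {xs} → AllPairs _≥_ xs → AllPairs _≥_ (map f xs)
map-sorted⁺ mono s = AllPairs.map⁺ (AllPairs.map mono s)

replicate-sorted : ∀ d x → AllPairs _≥_ (replicate d x)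
replicate-sorted zero    x = []
replicate-sorted (suc d) x = All.replicate⁺ d ≤-refl ∷ replicate-sorted d x

parts≤largestPart : ∀ xs → All (_≤ largestPart xs) xs
parts≤largestPart xs =
  foldr-forcesᵇ (λ x y p → m⊔n≤o⇒m≤o x y p , m⊔n≤o⇒n≤o x y p) 0 xs ≤-refl

largestPart-lub : ∀ {m xs} → All (_≤ m) xs → largestPart xs ≤ m
largestPart-lub = foldr-preservesᵇ ⊔-lub z≤n

-- Conjugation

-- Add a row of length x to a diagram with column lengths cs: the first x
-- columns grow by one, with new columns opened as necessary.  All the existing
-- columns grow, which is right when there are at most x of them.
addRow : ℕ → List ℕ → List ℕ
addRow x cs = map suc cs ++ replicate (x ∸ length cs) 1

-- The column lengths of the Young diagram with the given row lengths, which are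
-- meant to be weakly decreasing.
conjugate : List ℕ → List ℕ
conjugate = foldr addRow []

m+[n∸m]≡n⊔m : ∀ m n → m + (n ∸ m) ≡ n ⊔ m
m+[n∸m]≡n⊔m zero    zero    = refl
m+[n∸m]≡n⊔m zero    (suc n) = refl
m+[n∸m]≡n⊔m (suc m) zero    = cong suc (+-identityʳ m)
m+[n∸m]≡n⊔m (suc m) (suc n) = cong suc (m+[n∸m]≡n⊔m m n)

length-conjugate : ∀ xs → length (conjugate xs) ≡ largestPart xs
length-conjugate []       = refl
length-conjugate (x ∷ xs) = begin
  length (map suc cs ++ replicate d 1)          ≡⟨ length-++ (map suc cs) ⟩
  length (map suc cs) + length (replicate d 1)  ≡⟨ cong₂ _+_ (length-map suc cs) (length-replicate d) ⟩
  length cs + (x ∸ length cs)                   ≡⟨ m+[n∸m]≡n⊔m (length cs) x ⟩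
  x ⊔ length cs                                 ≡⟨ cong (x ⊔_) (length-conjugate xs) ⟩
  x ⊔ largestPart xs                            ∎
  where
  open ≡-Reasoning
  cs = conjugate xs
  d  = x ∸ length cs

conjugate-sorted : ∀ xs → AllPairs _≥_ (conjugate xs)
conjugate-sorted []       = []
conjugate-sorted (x ∷ xs) = AllPairs.++⁺
  (map-sorted⁺ s≤s (conjugate-sorted xs))
  (replicate-sorted _ 1)
  (All.map⁺ (All.universal (λ _ → All.replicate⁺ _ (s≤s z≤n)) (conjugate xs)))

conjugate-positive : ∀ xs → All (0 <_) (conjugate xs)
conjugate-positive []       = []
conjugate-positive (x ∷ xs) =
  All.++⁺ (All.map⁺ (All.universal (λ _ → z<s) (conjugate xs))) (All.replicate⁺ _ z<s)

length-conjugate-≤ : ∀ {x xs} → All (_≤ x) xs → length (conjugate xs) ≤ x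
length-conjugate-≤ {xs = xs} xs≤x =
  ≤-trans (≤-reflexive (length-conjugate xs)) (largestPart-lub xs≤x)

sum-replicate : ∀ d x → sum (replicate d x) ≡ d * x
sum-replicate zero    x = refl
sum-replicate (suc d) x = cong (x +_) (sum-replicate d x)

sum-map-+ : ∀ ℓ xs → sum (map (ℓ +_) xs) ≡ length xs * ℓ + sum xs
sum-map-+ ℓ []       = refl
sum-map-+ ℓ (x ∷ xs) = begin
  ℓ + x + sum (map (ℓ +_) xs)        ≡⟨ cong (ℓ + x +_) (sum-map-+ ℓ xs) ⟩
  ℓ + x + (length xs * ℓ + sum xs)   ≡⟨ solve 4 (λ a b c d → a :+ b :+ (c :+ d) := a :+ c :+ (b :+ d))
                                          refl ℓ x (length xs * ℓ) (sum xs) ⟩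
  ℓ + length xs * ℓ + (x + sum xs)   ∎
  where
  open ≡-Reasoning
  open +-*-Solver

sum-conjugate : ∀ {xs} → AllPairs _≥_ xs → sum (conjugate xs) ≡ sum xs
sum-conjugate []                     = refl
sum-conjugate {x ∷ xs} (xs≤x ∷ s) = begin
  sum (map suc cs ++ replicate d 1)          ≡⟨ sum-++ (map suc cs) _ ⟩
  sum (map suc cs) + sum (replicate d 1)     ≡⟨ cong₂ _+_ (sum-map-+ 1 cs) (sum-replicate d 1) ⟩
  (length cs * 1 + sum cs) + d * 1           ≡⟨ solve 3 (λ l m d → (l :* con 1 :+ m) :+ d :* con 1 := (l :+ d) :+ m)
                                                  refl (length cs) (sum cs) d ⟩
  (length cs + d) + sum cs                   ≡⟨ cong₂ _+_ (m+[n∸m]≡n (length-conjugate-≤ xs≤x)) (sum-conjugate s) ⟩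
  x + sum xs                                 ∎
  where
  open ≡-Reasoning
  open +-*-Solver
  cs = conjugate xs
  d  = x ∸ length cs

conjugate-ones : ∀ d → conjugate (replicate (suc d) 1) ≡ suc d ∷ []
conjugate-ones zero    = refl
conjugate-ones (suc d) = cong (addRow 1) (conjugate-ones d)

-- The left-hand list is `addRow (length cs + d) cs`: a diagram with columns cs
-- to which a row has been added.  Conjugating it recovers that row, followed by
-- the rows of the original diagram.  If the row were empty, its 0 would be lost.
conjugate-addRow : ∀ cs d → 0 < length cs + d →
  conjugate (map suc cs ++ replicate d 1) ≡ (length cs + d) ∷ conjugate cs
conjugate-addRow []            (suc d) _ = conjugate-ones d
conjugate-addRow (c ∷ [])      zero    _ = refl
conjugate-addRow (c ∷ [])      (suc d) _ =
  cong (addRow (suc c)) (conjugate-addRow [] (suc d) z<s)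
conjugate-addRow (c ∷ c′ ∷ cs) d       _ =
  cong (addRow (suc c)) (conjugate-addRow (c′ ∷ cs) d z<s)

conjugate-involutive : ∀ {xs} → AllPairs _≥_ xs → All (0 <_) xs →
                       conjugate (conjugate xs) ≡ xs
conjugate-involutive []                        _         = refl
conjugate-involutive {x ∷ xs} (xs≤x ∷ s) (x>0 ∷ xs>0) = begin
  conjugate (addRow x cs)           ≡⟨ conjugate-addRow cs d (subst (0 <_) (sym lx) x>0) ⟩
  (length cs + d) ∷ conjugate cs    ≡⟨ cong₂ _∷_ lx (conjugate-involutive s xs>0) ⟩
  x ∷ xs                            ∎
  where
  open ≡-Reasoning
  cs = conjugate xs
  d  = x ∸ length cs
  lx : length cs + d ≡ x
  lx = m+[n∸m]≡n (length-conjugate-≤ xs≤x)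

conjugate-nonempty : ∀ {xs} → AllPairs _≥_ xs → All (0 <_) xs → xs ≢ [] → conjugate xs ≢ []
conjugate-nonempty s p xs≢[] eq =
  xs≢[] (trans (sym (conjugate-involutive s p)) (cong conjugate eq))

conjugate-isPartition : ∀ {n xs} → IsPartition n xs → IsPartition n (conjugate xs)
conjugate-isPartition {xs = xs} p = record
  { multiset = AllPairs⇒Linked (conjugate-sorted xs)
  ; positive = conjugate-positive xs
  ; size     = trans (sum-conjugate (sorted multiset)) size
  }
  where open IsPartition p

conjugate-involutive-on-partitions : ∀ {n xs} → IsPartition n xs → conjugate (conjugate xs) ≡ xs
conjugate-involutive-on-partitions p = conjugate-involutive (sorted multiset) positive
  where open IsPartition p

total-length≡total-largestPart : ∀ n →
  sumOverPartitionsOf n length ≡ sumOverPartitionsOf n largestPart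
total-length≡total-largestPart n = begin
  sum (map length L)                   ≡⟨ sum-↭ (↭-map⁺ length conjugate-L) ⟨
  sum (map length (map conjugate L))   ≡⟨ cong sum (map-∘ L) ⟨
  sum (map (length ∘ conjugate) L)     ≡⟨ cong sum (map-cong length-conjugate L) ⟩
  sum (map largestPart L)              ∎
  where
  open ≡-Reasoning
  L = list (partitionsOf n)
  conjugate-L : map conjugate L ↭ L
  conjugate-L = map-enumeration-↭ (partitionsOf n) (partitionsOf n) conjugate conjugate
    conjugate-isPartition conjugate-isPartition
    conjugate-involutive-on-partitions conjugate-involutive-on-partitions

-- Marked partitions

-- A partition of n with a marked part, encoded as its parts before the marked
-- one and its parts from the marked one on.
record IsMarkedPartition (n : ℕ) (p : List ℕ × List ℕ) : Set where
  field
    partition : IsPartition n (proj₁ p ++ proj₂ p)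
    nonempty  : proj₂ p ≢ []

-- All ways to write a list as α ++ β with β nonempty.
splits : {A : Set} → List A → List (List A × List A)
splits []       = []
splits (x ∷ xs) = ([] , x ∷ xs) ∷ map (map₁ (x ∷_)) (splits xs)

module _ {A : Set} where

  length-splits : (xs : List A) → length (splits xs) ≡ length xs
  length-splits []       = refl
  length-splits (x ∷ xs) = cong suc (trans (length-map _ (splits xs)) (length-splits xs))

  splits-sound : ∀ (xs : List A) {p} → p ∈ splits xs → proj₁ p ++ proj₂ p ≡ xs × proj₂ p ≢ []
  splits-sound (x ∷ xs) (here refl) = refl , λ ()
  splits-sound (x ∷ xs) (there p∈) with ∈-map⁻ (map₁ (x ∷_)) p∈
  ... | q , q∈ , refl = map₁ (cong (x ∷_)) (splits-sound xs q∈)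

  splits-complete : ∀ (α β : List A) → β ≢ [] → (α , β) ∈ splits (α ++ β)
  splits-complete []      []      β≢[] = contradiction refl β≢[]
  splits-complete []      (_ ∷ _) _    = here refl
  splits-complete (x ∷ α) β       β≢[] = there (∈-map⁺ (map₁ (x ∷_)) (splits-complete α β β≢[]))

  splits-unique : (xs : List A) → Unique (splits xs)
  splits-unique []       = []
  splits-unique (x ∷ xs) =
    All.map⁺ (All.universal (λ _ ()) (splits xs))
    ∷ Unique.map⁺ (λ eq → cong₂ _,_ (∷-injectiveʳ (cong proj₁ eq)) (cong proj₂ eq)) (splits-unique xs)

  -- A split determines the list that it splits.
  splits-disjoint : {xs ys : List A} → xs ≢ ys → Disjoint (splits xs) (splits ys)
  splits-disjoint {xs} {ys} xs≢ys (p∈xs , p∈ys) =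
    xs≢ys (trans (sym (proj₁ (splits-sound xs p∈xs))) (proj₁ (splits-sound ys p∈ys)))

length-concatMap-splits : {A : Set} (xss : List (List A)) →
                          length (concatMap splits xss) ≡ sum (map length xss)
length-concatMap-splits []         = refl
length-concatMap-splits (xs ∷ xss) =
  trans (length-++ (splits xs)) (cong₂ _+_ (length-splits xs) (length-concatMap-splits xss))

markedPartitionsOf : ∀ n → Enumeration (IsMarkedPartition n)
markedPartitionsOf n = record
  { list     = concatMap splits L
  ; unique   = Unique.concat⁺
      (All.map⁺ (All.universal splits-unique L))
      (AllPairs.map⁺ (AllPairs.map splits-disjoint (unique (partitionsOf n))))
  ; sound    = marked-sound
  ; complete = λ {(α , β)} m → let open IsMarkedPartition m in
      ∈-concatMap⁺ splits (lose (complete (partitionsOf n) partition) (splits-complete α β nonempty))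
  }
  where
  L = list (partitionsOf n)
  marked-sound : ∀ {p} → p ∈ concatMap splits L → IsMarkedPartition n p
  marked-sound p∈ with find (∈-concatMap⁻ splits {xs = L} p∈)
  ... | xs , xs∈ , p∈xs with splits-sound xs p∈xs
  ... | refl , nonempty = record { partition = sound (partitionsOf n) xs∈ ; nonempty = nonempty }

-- Marked partitions and copartitions

toCopartition : List ℕ × List ℕ → Triple
toCopartition (α , β) = map (_∸ ℓ) α , rectangle ℓ (length α) , σ
  where
  σ = conjugate β
  ℓ = length σ

fromCopartition : Triple → List ℕ × List ℕ
fromCopartition (γ , _ , σ) = map (length σ +_) γ , conjugate σ

sum-rectangle : ∀ ℓ k → sum (rectangle ℓ k) ≡ k * ℓ
sum-rectangle ℓ zero    = refl
sum-rectangle ℓ (suc k) = trans (sum-replicate ℓ (suc k)) (*-comm ℓ (suc k))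

-- Removing or restoring the rectangle preserves size.  The statement for
-- fromCopartition gives the one for toCopartition as well, by way of
-- `from∘toCopartition`.
sum-fromCopartition : ∀ γ {σ} → AllPairs _≥_ σ →
  sum (map (length σ +_) γ ++ conjugate σ) ≡
  sum γ + sum (rectangle (length σ) (length γ)) + sum σ
sum-fromCopartition γ {σ} s = begin
  sum (map (ℓ +_) γ ++ conjugate σ)               ≡⟨ sum-++ (map (ℓ +_) γ) _ ⟩
  sum (map (ℓ +_) γ) + sum (conjugate σ)          ≡⟨ cong₂ _+_ (sum-map-+ ℓ γ) (sum-conjugate s) ⟩
  length γ * ℓ + sum γ + sum σ                    ≡⟨ cong (_+ sum σ) (+-comm _ (sum γ)) ⟩
  sum γ + length γ * ℓ + sum σ                    ≡⟨ cong (λ r → sum γ + r + sum σ) (sum-rectangle ℓ (length γ)) ⟨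
  sum γ + sum (rectangle ℓ (length γ)) + sum σ    ∎
  where
  open ≡-Reasoning
  ℓ = length σ

fromCopartition-isMarked : ∀ {n t} → IsCopartition₀₁₁Of n t → IsMarkedPartition n (fromCopartition t)
fromCopartition-isMarked {n} {γ , ρ , σ} c = record
  { partition = record
    { multiset = AllPairs⇒Linked (AllPairs.++⁺
        (map-sorted⁺ (+-monoʳ-≤ ℓ) (sorted γ-multiset))
        (conjugate-sorted σ)
        (All.map⁺ (All.universal (λ x → All.map (λ y≤ℓ → ≤-trans y≤ℓ (m≤m+n ℓ x)) conjugate≤ℓ) γ)))
    ; positive = All.++⁺
        (All.map⁺ (All.universal (λ x → ≤-trans (ℓ-positive σ σ-nonempty) (m≤m+n ℓ x)) γ))
        (conjugate-positive σ)
    ; size     = begin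
        sum (map (ℓ +_) γ ++ conjugate σ)             ≡⟨ sum-fromCopartition γ σ-sorted ⟩
        sum γ + sum (rectangle ℓ (length γ)) + sum σ  ≡⟨ cong (λ r → sum γ + sum r + sum σ) ρ-parts ⟨
        sum γ + sum ρ + sum σ                         ≡⟨ size ⟩
        n                                             ∎
    }
  ; nonempty  = conjugate-nonempty σ-sorted σ-positive σ-nonempty
  }
  where
  open ≡-Reasoning
  open IsCopartition₀₁₁Of c using (copartition; size)
  open IsCopartition₀₁₁ copartition
  ℓ = length σ
  σ-sorted = sorted σ-multiset

  -- The largest part of the conjugate of σ is the length of its conjugate, σ.
  conjugate≤ℓ : All (_≤ ℓ) (conjugate σ)
  conjugate≤ℓ = subst (λ m → All (_≤ m) (conjugate σ))
    (trans (sym (length-conjugate (conjugate σ)))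
           (cong length (conjugate-involutive σ-sorted σ-positive)))
    (parts≤largestPart (conjugate σ))

  ℓ-positive : ∀ σ → σ ≢ [] → 0 < length σ
  ℓ-positive []      σ≢[] = contradiction refl σ≢[]
  ℓ-positive (_ ∷ _) _    = z<s

to∘fromCopartition : ∀ {n t} → IsCopartition₀₁₁Of n t → toCopartition (fromCopartition t) ≡ t
to∘fromCopartition {t = γ , ρ , σ} c
  rewrite conjugate-involutive (sorted (IsCopartition₀₁₁.σ-multiset (IsCopartition₀₁₁Of.copartition c)))
                               (IsCopartition₀₁₁.σ-positive (IsCopartition₀₁₁Of.copartition c))
  = cong₂ _,_
      (begin
        map (_∸ ℓ) (map (ℓ +_) γ)  ≡⟨ map-∘ γ ⟨
        map (λ x → ℓ + x ∸ ℓ) γ    ≡⟨ map-cong (m+n∸m≡n ℓ) γ ⟩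
        map (λ x → x) γ            ≡⟨ map-id γ ⟩
        γ                          ∎)
      (cong (_, σ) (trans (cong (rectangle ℓ) (length-map (ℓ +_) γ)) (sym ρ-parts)))
  where
  open ≡-Reasoning
  open IsCopartition₀₁₁ (IsCopartition₀₁₁Of.copartition c)
  ℓ = length σ

module _ {n α β} (m : IsMarkedPartition n (α , β)) where

  open IsMarkedPartition m
  open IsPartition partition

  private
    α-sorted : AllPairs _≥_ α
    α-sorted = proj₁ (++-sorted⁻ α (sorted multiset))

    β-sorted : AllPairs _≥_ β
    β-sorted = proj₁ (proj₂ (++-sorted⁻ α (sorted multiset)))

    β≤α : All (λ x → All (_≤ x) β) α
    β≤α = proj₂ (proj₂ (++-sorted⁻ α (sorted multiset)))

    β-positive : All (0 <_) β
    β-positive = All.++⁻ʳ α positive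

    ℓ : ℕ
    ℓ = length (conjugate β)

  from∘toCopartition : fromCopartition (toCopartition (α , β)) ≡ (α , β)
  from∘toCopartition = cong₂ _,_
    (trans (sym (map-∘ α))
           (map-id-local (All.map (m+[n∸m]≡n ∘ length-conjugate-≤) β≤α)))
    (conjugate-involutive β-sorted β-positive)

  toCopartition-isCopartition : IsCopartition₀₁₁Of n (toCopartition (α , β))
  toCopartition-isCopartition = record
    { copartition = record
      { γ-multiset = AllPairs⇒Linked (map-sorted⁺ (∸-monoˡ-≤ ℓ) α-sorted)
      ; σ-multiset = AllPairs⇒Linked (conjugate-sorted β)
      ; σ-positive = conjugate-positive β
      ; σ-nonempty = conjugate-nonempty β-sorted β-positive nonempty
      ; ρ-parts    = cong (rectangle ℓ) (sym (length-map (_∸ ℓ) α))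
      }
    ; size = begin
        sum γ + sum (rectangle ℓ (length α)) + sum σ  ≡⟨ cong (λ k → sum γ + sum (rectangle ℓ k) + sum σ) (length-map (_∸ ℓ) α) ⟨
        sum γ + sum (rectangle ℓ (length γ)) + sum σ  ≡⟨ sum-fromCopartition γ (conjugate-sorted β) ⟨
        sum (map (ℓ +_) γ ++ conjugate σ)             ≡⟨ cong (λ p → sum (proj₁ p ++ proj₂ p)) from∘toCopartition ⟩
        sum (α ++ β)                                  ≡⟨ size ⟩
        n                                             ∎
    }
    where
    open ≡-Reasoning
    γ = map (_∸ ℓ) α
    σ = conjugate β

cp₀₁₁≡total-length : ∀ n → cp₀₁₁ n ≡ sumOverPartitionsOf n length
cp₀₁₁≡total-length n = begin
  length (list (copartitions₀₁₁Of n))     ≡⟨ ↭-length toCopartition-L ⟨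
  length (map toCopartition marked)       ≡⟨ length-map toCopartition marked ⟩
  length marked                           ≡⟨ length-concatMap-splits (list (partitionsOf n)) ⟩
  sumOverPartitionsOf n length            ∎
  where
  open ≡-Reasoning
  marked = list (markedPartitionsOf n)
  toCopartition-L : map toCopartition marked ↭ list (copartitions₀₁₁Of n)
  toCopartition-L = map-enumeration-↭ (markedPartitionsOf n) (copartitions₀₁₁Of n)
    toCopartition fromCopartition
    toCopartition-isCopartition fromCopartition-isMarked
    from∘toCopartition to∘fromCopartition

theorem4p12 : (n : ℕ) →
    (cp₀₁₁ n ≡ sumOverPartitionsOf n length) ×
    (cp₀₁₁ n ≡ sumOverPartitionsOf n largestPart)
theorem4p12 n =
  cp₀₁₁≡total-length n ,
  trans (cp₀₁₁≡total-length n) (total-length≡total-largestPart n)
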